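{- The varieties $\mathbb{RDMP}$ (regular De Morgan p-algebras) and $\mathbb{RDMDBLH}$ (regular De Morgan double Heyting algebras) are term-equivalent to each other. More explicitly: (a) For $\mathbf A = \langle A,\lor,\land,{}^*,{}',0,1\rangle\in \mathbb{RDMP}$, let $\mathbf{A}^{dmdblh} := \langle A, \lor, \land, \to, \leftarrow, {}', 0, 1 \rangle$, where, with $x^+ := x'{}^*{}'$, $x\to y := (x^{*} \lor y^{**})^{**} \land [(x \lor x^{*})^{+} \lor x^{*} \lor y \lor y^{*}]$ and $x\leftarrow y := (x^{+} \land y^{++})^{++} \lor [(x \land x^{+})^{*} \land x^{+} \land y \land y^{+}]$. Then $\mathbf{A}^{dmdblh} \in \mathbb{RDMDBLH}$. (b) For $\mathbf A = \langle A,\lor,\land,\to,\leftarrow,{}',0,1\rangle\in \mathbb{RDMDBLH}$, let $\mathbf{A}^{dmp} := \langle A, \lor, \land, {}^*, {}', 0, 1 \rangle$, where $x^*:=x\to 0$. Then $\mathbf{A}^{dmp} \in \mathbb{RDMP}$. (c) If $\mathbf A \in \mathbb{RDMP}$, then $(\mathbf A^{dmdblh})^{dmp} = \mathbf A$. (d) If $\mathbf A \in \mathbb{RDMDBLH}$, then $(\mathbf A^{dmp})^{dmdblh} = \mathbf A$.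
   Context: A De Morgan algebra is a bounded distributive lattice with a unary operation ${}'$ satisfying $x''\approx x$, $(x\vee y)'\approx x'\wedge y'$, $(x\wedge y)'\approx x'\vee y'$, $0'\approx1$, $1'\approx0$. Write $x'{}^*{}'$ for $((x')^*)'$. $\mathbb{RDMP}$: algebras $\langle A,\vee,\wedge,{}^*,{}',0,1\rangle$ such that $\langle A,\vee,\wedge,{}',0,1\rangle$ is a De Morgan algebra, ${}^*$ is the pseudocomplement ($x^*$ is the largest $z$ with $x\wedge z=0$), and the regularity identity $(x\wedge x'{}^*{}')\vee(y\vee y^*)\approx y\vee y^*$ holds. $\mathbb{RDMDBLH}$: algebras $\langle A,\vee,\wedge,\to,\leftarrow,{}',0,1\rangle$ such that $\langle A,\vee,\wedge,{}',0,1\rangle$ is a De Morgan algebra, $x\to y$ is the largest $z$ with $x\wedge z\le y$, $x\leftarrow y$ is the least $z$ with $y\le x\vee z$, and the same regularity identity holds with $x^*:=x\to0$. Term-equivalence here means precisely the content of (a)-(d). -}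

module Defs where

open import Algebra.Core using (Op₁; Op₂)
open import Algebra.Definitions using (Congruent₁; Congruent₂; Involutive)
open import Algebra.Lattice.Structures using (IsDistributiveLattice)
open import Data.Product.Base using (_×_)
open import Level using (Level; _⊔_)
open import Relation.Binary.Core using (Rel)
open import Relation.Binary.Definitions using (Minimum; Maximum)
import Relation.Binary.Construct.NaturalOrder.Left as NaturalOrder

private
  variable
    c ℓ ℓ′ : Level

record RawDMP (A : Set c) : Set c where
  infixl 9 _* _′
  infixr 7 _∧_
  infixr 6 _∨_
  field
    _∨_ _∧_ : Op₂ A
    _* _′   : Op₁ A
    0# 1#   : A

record RawDMDBLH (A : Set c) : Set c where
  infixl 9 _′
  infixr 7 _∧_
  infixr 6 _∨_
  infix  5 _⇨_ _⇦_
  field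
    _∨_ _∧_ : Op₂ A
    _⇨_ _⇦_ : Op₂ A
    _′      : Op₁ A
    0# 1#   : A

IsLargest : {A : Set c} → Rel A ℓ → (A → Set ℓ′) → A → Set _
IsLargest _≤_ P m = P m × (∀ z → P z → z ≤ m)

IsSmallest : {A : Set c} → Rel A ℓ → (A → Set ℓ′) → A → Set _
IsSmallest _≤_ P m = P m × (∀ z → P z → m ≤ z)

-- Algebras are taken up to an equality _≈_ on the carrier, so each operation
-- must respect _≈_. The order is the lattice order: x ≤ y means x ≈ x ∧ y.
module _ {A : Set c} (_≈_ : Rel A ℓ) where

  record IsDeMorganAlgebra (_∨_ _∧_ : Op₂ A) (_′ : Op₁ A) (0# 1# : A)
                           : Set (c ⊔ ℓ) where
    open NaturalOrder _≈_ _∧_ using (_≤_)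
    field
      isDistributiveLattice : IsDistributiveLattice _≈_ _∨_ _∧_
      minimum               : Minimum _≤_ 0#
      maximum               : Maximum _≤_ 1#
      ′-cong                : Congruent₁ _≈_ _′
      ′-involutive          : Involutive _≈_ _′
      ′-deMorgan-∨          : ∀ x y → ((x ∨ y) ′) ≈ ((x ′) ∧ (y ′))
      ′-deMorgan-∧          : ∀ x y → ((x ∧ y) ′) ≈ ((x ′) ∨ (y ′))
      0′≈1                  : (0# ′) ≈ 1#
      1′≈0                  : (1# ′) ≈ 0#

    open IsDistributiveLattice isDistributiveLattice public

  Regular : (_∨_ _∧_ : Op₂ A) (_* _′ : Op₁ A) → Set _
  Regular _∨_ _∧_ _* _′ =
    ∀ x y → ((x ∧ (((x ′) *) ′)) ∨ (y ∨ (y *))) ≈ (y ∨ (y *))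

  record IsRDMP (𝐀 : RawDMP A) : Set (c ⊔ ℓ) where
    open RawDMP 𝐀
    open NaturalOrder _≈_ _∧_ using (_≤_)
    field
      isDeMorganAlgebra : IsDeMorganAlgebra _∨_ _∧_ _′ 0# 1#
      *-cong            : Congruent₁ _≈_ _*
      *-pseudocomplement : ∀ x → IsLargest _≤_ (λ z → (x ∧ z) ≈ 0#) (x *)
      regular           : Regular _∨_ _∧_ _* _′

    open IsDeMorganAlgebra isDeMorganAlgebra public

  record IsRDMDBLH (𝐀 : RawDMDBLH A) : Set (c ⊔ ℓ) where
    open RawDMDBLH 𝐀
    open NaturalOrder _≈_ _∧_ using (_≤_)
    field
      isDeMorganAlgebra : IsDeMorganAlgebra _∨_ _∧_ _′ 0# 1#
      ⇨-cong            : Congruent₂ _≈_ _⇨_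
      ⇦-cong            : Congruent₂ _≈_ _⇦_
      ⇨-largest         : ∀ x y → IsLargest _≤_ (λ z → (x ∧ z) ≤ y) (x ⇨ y)
      ⇦-smallest        : ∀ x y → IsSmallest _≤_ (λ z → y ≤ (x ∨ z)) (x ⇦ y)
      regular           : Regular _∨_ _∧_ (_⇨ 0#) _′

    open IsDeMorganAlgebra isDeMorganAlgebra public

  -- Equality of algebras on the same carrier: every basic operation and
  -- constant agrees.
  record EqualDMP (𝐀 𝐁 : RawDMP A) : Set (c ⊔ ℓ) where
    private
      module 𝐀 = RawDMP 𝐀
      module 𝐁 = RawDMP 𝐁
    field
      ∨-≈ : ∀ x y → (x 𝐀.∨ y) ≈ (x 𝐁.∨ y)
      ∧-≈ : ∀ x y → (x 𝐀.∧ y) ≈ (x 𝐁.∧ y)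
      *-≈ : ∀ x → (x 𝐀.*) ≈ (x 𝐁.*)
      ′-≈ : ∀ x → (x 𝐀.′) ≈ (x 𝐁.′)
      0-≈ : 𝐀.0# ≈ 𝐁.0#
      1-≈ : 𝐀.1# ≈ 𝐁.1#

  record EqualDMDBLH (𝐀 𝐁 : RawDMDBLH A) : Set (c ⊔ ℓ) where
    private
      module 𝐀 = RawDMDBLH 𝐀
      module 𝐁 = RawDMDBLH 𝐁
    field
      ∨-≈ : ∀ x y → (x 𝐀.∨ y) ≈ (x 𝐁.∨ y)
      ∧-≈ : ∀ x y → (x 𝐀.∧ y) ≈ (x 𝐁.∧ y)
      ⇨-≈ : ∀ x y → (x 𝐀.⇨ y) ≈ (x 𝐁.⇨ y)
      ⇦-≈ : ∀ x y → (x 𝐀.⇦ y) ≈ (x 𝐁.⇦ y)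
      ′-≈ : ∀ x → (x 𝐀.′) ≈ (x 𝐁.′)
      0-≈ : 𝐀.0# ≈ 𝐁.0#
      1-≈ : 𝐀.1# ≈ 𝐁.1#

module DMPTerms {A : Set c} (𝐀 : RawDMP A) where
  open RawDMP 𝐀

  infixl 9 _⁺
  _⁺ : Op₁ A
  x ⁺ = x ′ * ′

  implication : Op₂ A
  implication x y =
    (x * ∨ y * *) * * ∧ ((x ∨ x *) ⁺ ∨ x * ∨ y ∨ y *)

  coimplication : Op₂ A
  coimplication x y =
    (x ⁺ ∧ y ⁺ ⁺) ⁺ ⁺ ∨ ((x ∧ x ⁺) * ∧ x ⁺ ∧ y ∧ y ⁺)

infixl 9 _^dmdblh _^dmp

_^dmdblh : {A : Set c} → RawDMP A → RawDMDBLH A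
𝐀 ^dmdblh = record
  { _∨_ = _∨_ ; _∧_ = _∧_
  ; _⇨_ = implication ; _⇦_ = coimplication
  ; _′ = _′ ; 0# = 0# ; 1# = 1#
  }
  where open RawDMP 𝐀; open DMPTerms 𝐀

_^dmp : {A : Set c} → RawDMDBLH A → RawDMP A
𝐀 ^dmp = record
  { _∨_ = _∨_ ; _∧_ = _∧_
  ; _* = _⇨ 0#
  ; _′ = _′ ; 0# = 0# ; 1# = 1#
  }
  where open RawDMDBLH 𝐀

{-# OPTIONS --safe #-}

-- In an RDMP, x ⁺ is a dual pseudocomplement and regularity says that
-- x ∧ x ⁺ ≤ y ∨ y * for all x, y, so the reduct is a regular double p-algebra.
-- There x → y := (x * ∨ y * *) * * ∧ ((x ∨ x *) ⁺ ∨ x * ∨ y ∨ y *) is the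
-- relative pseudocomplement. The first factor meets x below y * *, and
-- y * * ∧ (y ∨ y *) ≤ y; the term (x ∨ x *) ⁺ is handled by regularity, since
-- x ∧ (x ∨ x *) ⁺ ≤ y ∨ y *. Conversely, if x ∧ z ≤ y then z lies below the
-- second factor because z = (z ∧ (x ∨ x *)) ∨ (z ∧ (x ∨ x *) ⁺). The hypotheses
-- are self-dual, which settles ←. The remaining claims follow from uniqueness
-- of residuals.
module Submission where

open import Defs
open import Algebra.Definitions using (Congruent₂)
import Algebra.Lattice.Bundles as Alg
import Algebra.Lattice.Properties.Lattice as AlgLatticeProperties
open import Algebra.Core using (Op₁; Op₂)
open import Data.Product.Base using (_×_; _,_; proj₁; proj₂)
open import Function.Base using (flip; id)
open import Level using (Level; _⊔_)
open import Relation.Binary.Core using (Rel)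
open import Relation.Binary.Definitions using (Antisymmetric; Minimum; Maximum)
open import Relation.Binary.Lattice using (Lattice; DistributiveLattice)
import Relation.Binary.Lattice.Properties.DistributiveLattice as DistributiveLatticeProperties
import Relation.Binary.Lattice.Properties.Lattice as LatticeProperties
import Relation.Binary.Lattice.Properties.MeetSemilattice as MeetProperties

private
  variable
    c ℓ ℓ₁ ℓ₂ p q : Level

-- Residuals in a lattice.

largest-unique : {A : Set c} {_≈_ : Rel A ℓ₁} {_≤_ : Rel A ℓ₂} →
  Antisymmetric _≈_ _≤_ → {P : A → Set p} {Q : A → Set q} →
  (∀ {z} → P z → Q z) → (∀ {z} → Q z → P z) →
  ∀ {m n} → IsLargest _≤_ P m → IsLargest _≤_ Q n → m ≈ n
largest-unique antisym P⇒Q Q⇒P (Pm , m-max) (Qn , n-max) =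
  antisym (n-max _ (P⇒Q Pm)) (m-max _ (Q⇒P Qn))

module _ (L : Lattice c ℓ₁ ℓ₂) where
  open Lattice L
  open MeetProperties meetSemilattice using (∧-monotonic)

  -- Stated for an arbitrary lattice: over the order dual it becomes the defining property of `⇦`.
  IsResidual : Op₂ Carrier → Set _
  IsResidual _⇨_ = ∀ x y → IsLargest _≤_ (λ z → (x ∧ z) ≤ y) (x ⇨ y)

  residual-unique : ∀ {_⇨₁_ _⇨₂_} → IsResidual _⇨₁_ → IsResidual _⇨₂_ →
    ∀ x y → (x ⇨₁ y) ≈ (x ⇨₂ y)
  residual-unique res₁ res₂ x y =
    largest-unique {_≤_ = _≤_} antisym id id (res₁ x y) (res₂ x y)

  -- Equal arguments give equivalent conditions on `z`, and equivalent conditions share their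
  -- largest element.
  residual-cong : ∀ {_⇨_} → IsResidual _⇨_ → Congruent₂ _≈_ _⇨_
  residual-cong res {x₁} {x₂} {y₁} {y₂} x₁≈x₂ y₁≈y₂ =
    largest-unique {_≤_ = _≤_} antisym
      (transport x₁≈x₂ y₁≈y₂) (transport (Eq.sym x₁≈x₂) (Eq.sym y₁≈y₂))
      (res x₁ y₁) (res x₂ y₂)
    where
    transport : ∀ {a b d e z} → a ≈ b → d ≈ e → (a ∧ z) ≤ d → (b ∧ z) ≤ e
    transport a≈b d≈e a∧z≤d =
      trans (∧-monotonic (reflexive (Eq.sym a≈b)) refl)
            (trans a∧z≤d (reflexive d≈e))

-- Regular double p-algebras and order duality.

dualDistributiveLattice :
  DistributiveLattice c ℓ₁ ℓ₂ → DistributiveLattice c ℓ₁ ℓ₂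
dualDistributiveLattice D = record
  { isDistributiveLattice = record
    { isLattice    = LatticeProperties.∧-∨-isLattice lattice
    ; ∧-distribˡ-∨ = DistributiveLatticeProperties.∨-distribˡ-∧ D
    }
  }
  where open DistributiveLattice D

-- With `≤ 0#` rather than `≈ 0#`, `*-largest` is literally the residual condition at `0#`.
record IsRegularDoublePAlgebra (D : DistributiveLattice c ℓ₁ ℓ₂)
  (_* _⁺ : Op₁ (DistributiveLattice.Carrier D))
  (0# 1# : DistributiveLattice.Carrier D) : Set (c ⊔ ℓ₂) where
  open DistributiveLattice D
  field
    minimum    : Minimum _≤_ 0#
    maximum    : Maximum _≤_ 1#
    *-largest  : ∀ x → IsLargest _≤_ (λ z → (x ∧ z) ≤ 0#) (x *)
    ⁺-smallest : ∀ x → IsSmallest _≤_ (λ z → 1# ≤ (x ∨ z)) (x ⁺)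
    regular    : ∀ x y → (x ∧ (x ⁺)) ≤ (y ∨ (y *))

-- Reversing the order exchanges `*` with `⁺` and `0#` with `1#`; regularity turns into itself with
-- its two variables swapped.
dualIsRegularDoublePAlgebra : {D : DistributiveLattice c ℓ₁ ℓ₂} →
  ∀ {_* _⁺ 0# 1#} → IsRegularDoublePAlgebra D _* _⁺ 0# 1# →
  IsRegularDoublePAlgebra (dualDistributiveLattice D) _⁺ _* 1# 0#
dualIsRegularDoublePAlgebra isRDP = record
  { minimum    = maximum
  ; maximum    = minimum
  ; *-largest  = ⁺-smallest
  ; ⁺-smallest = *-largest
  ; regular    = flip regular
  }
  where open IsRegularDoublePAlgebra isRDP

-- The relative pseudocomplement of a regular double p-algebra.

module RegularDoublePAlgebra (D : DistributiveLattice c ℓ₁ ℓ₂)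
  {_* _⁺ : Op₁ (DistributiveLattice.Carrier D)}
  {0# 1# : DistributiveLattice.Carrier D}
  (isRDP : IsRegularDoublePAlgebra D _* _⁺ 0# 1#) where

  open DistributiveLattice D
  open IsRegularDoublePAlgebra isRDP
  open MeetProperties meetSemilattice using (∧-monotonic; ∧-comm; ∧-assoc)

  *-intro : ∀ {x z} → (z ∧ x) ≤ 0# → z ≤ (x *)
  *-intro z∧x≤0 = proj₂ (*-largest _) _ (trans (reflexive (∧-comm _ _)) z∧x≤0)

  -- Ex falso in order form: such a `z` is below 0, hence below anything.
  *-absurd : ∀ {x z} y → z ≤ x → z ≤ (x *) → z ≤ y
  *-absurd y z≤x z≤x* =
    trans (∧-greatest z≤x z≤x*) (trans (proj₁ (*-largest _)) (minimum y))

  x≤x** : ∀ {x} → x ≤ ((x *) *)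
  x≤x** = *-intro (*-absurd _ (x∧y≤x _ _) (x∧y≤y _ _))

  ∧-∨-elim : ∀ {x a b y} → (x ∧ a) ≤ y → (x ∧ b) ≤ y → (x ∧ (a ∨ b)) ≤ y
  ∧-∨-elim x∧a≤y x∧b≤y =
    trans (reflexive (∧-distribˡ-∨ _ _ _)) (∨-least x∧a≤y x∧b≤y)

  x**∧[x∨x*]≤x : ∀ {x} → (((x *) *) ∧ (x ∨ (x *))) ≤ x
  x**∧[x∨x*]≤x =
    ∧-∨-elim (x∧y≤y _ _) (*-absurd _ (x∧y≤y _ _) (x∧y≤x _ _))

  _⇨_ : Op₂ Carrier
  x ⇨ y = ((((x *) ∨ ((y *) *)) *) *)
          ∧ (((x ∨ (x *)) ⁺) ∨ ((x *) ∨ (y ∨ (y *))))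

  ⇨-isResidual : IsResidual lattice _⇨_
  ⇨-isResidual x y = x∧[x⇨y]≤y , greatest
    where
    d t v w : Carrier
    d = x ∨ (x *)
    t = (x *) ∨ ((y *) *)
    v = (t *) *
    w = (d ⁺) ∨ ((x *) ∨ (y ∨ (y *)))

    -- Each joinand of `t` is disjoint from one factor: `x *` from `x`, and `y * *` from `y *`.
    x∧y*≤t* : (x ∧ (y *)) ≤ (t *)
    x∧y*≤t* = *-intro (∧-∨-elim
      (*-absurd _ (trans (x∧y≤x _ _) (x∧y≤x _ _)) (x∧y≤y _ _))
      (*-absurd _ (trans (x∧y≤x _ _) (x∧y≤y _ _)) (x∧y≤y _ _)))

    -- Meeting `x ∧ v` with `y *` gives an element below both `t *` and `v`, the pseudocomplement of
    -- `t *`.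
    x∧v≤y** : (x ∧ v) ≤ ((y *) *)
    x∧v≤y** = *-intro (*-absurd _
      (trans (∧-monotonic (x∧y≤x _ _) refl) x∧y*≤t*)
      (trans (x∧y≤x _ _) (x∧y≤y _ _)))

    x∧d⁺≤y∨y* : (x ∧ (d ⁺)) ≤ (y ∨ (y *))
    x∧d⁺≤y∨y* = trans (∧-monotonic (x≤x∨y _ _) refl) (regular d y)

    ≤y-if-≤y∨y* : ∀ {z} → z ≤ (x ∧ v) → z ≤ (y ∨ (y *)) → z ≤ y
    ≤y-if-≤y∨y* z≤x∧v z≤y∨y* =
      trans (∧-greatest (trans z≤x∧v x∧v≤y**) z≤y∨y*) x**∧[x∨x*]≤x

    -- Distribute over the three joinands of `w`: `d ⁺`, `x *` and `y ∨ y *`.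
    x∧[x⇨y]≤y : (x ∧ (x ⇨ y)) ≤ y
    x∧[x⇨y]≤y = trans (reflexive (Eq.sym (∧-assoc x v w))) (∧-∨-elim
      (≤y-if-≤y∨y* (x∧y≤x _ _)
        (trans (∧-monotonic (x∧y≤x _ _) refl) x∧d⁺≤y∨y*))
      (∧-∨-elim
        (*-absurd _ (trans (x∧y≤x _ _) (x∧y≤x _ _)) (x∧y≤y _ _))
        (≤y-if-≤y∨y* (x∧y≤x _ _) (x∧y≤y _ _))))

    module _ (z : Carrier) (x∧z≤y : (x ∧ z) ≤ y) where

      -- Meeting with `x` lands below `y`, hence below `y * *` and `t`, while staying below `t *`.
      z∧t*≤x* : (z ∧ (t *)) ≤ (x *)
      z∧t*≤x* = *-intro (*-absurd _
        (trans (∧-greatest (x∧y≤y _ _) (trans (x∧y≤x _ _) (x∧y≤x _ _)))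
          (trans x∧z≤y (trans x≤x** (y≤x∨y _ _))))
        (trans (x∧y≤x _ _) (x∧y≤y _ _)))

      z≤v : z ≤ v
      z≤v = *-intro (*-absurd _ (trans z∧t*≤x* (x≤x∨y _ _)) (x∧y≤y _ _))

      z≤d∨d⁺ : z ≤ (d ∨ (d ⁺))
      z≤d∨d⁺ = trans (maximum z) (proj₁ (⁺-smallest d))

      z∧x≤w : (z ∧ x) ≤ w
      z∧x≤w = trans (reflexive (∧-comm z x)) (trans x∧z≤y
        (trans (x≤x∨y _ _) (trans (y≤x∨y _ _) (y≤x∨y _ _))))

      z≤w : z ≤ w
      -- Three cases for `z`: its meets with `x`, `x *` and `d ⁺`.
      z≤w = trans (∧-greatest refl z≤d∨d⁺) (∧-∨-elim
        (∧-∨-elim z∧x≤w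
          (trans (x∧y≤y _ _) (trans (x≤x∨y _ _) (y≤x∨y _ _))))
        (trans (x∧y≤y _ _) (x≤x∨y _ _)))

      greatest : z ≤ (x ⇨ y)
      greatest = ∧-greatest z≤v z≤w

-- Order and negation in De Morgan algebras.

module DeMorganAlgebra {A : Set c} {_≈_ : Rel A ℓ} {_∨_ _∧_ : Op₂ A}
  {_′ : Op₁ A} {0# 1# : A}
  (isDeMorgan : IsDeMorganAlgebra _≈_ _∨_ _∧_ _′ 0# 1#) where

  open IsDeMorganAlgebra isDeMorgan hiding (reflexive)

  -- Its order unfolds to `x ≈ x ∧ y`, so results over it apply to the algebra without conversion.
  distributiveLattice : DistributiveLattice c ℓ ℓ
  distributiveLattice = record
    { isDistributiveLattice = record
      { isLattice    =
          AlgLatticeProperties.∨-∧-isOrderTheoreticLattice algLattice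
      ; ∧-distribˡ-∨ = ∧-distribˡ-∨
      }
    }
    where
    algLattice : Alg.Lattice c ℓ
    algLattice = record { isLattice = isLattice }

  lattice : Lattice c ℓ ℓ
  lattice = DistributiveLattice.lattice distributiveLattice

  dualLattice : Lattice c ℓ ℓ
  dualLattice = LatticeProperties.∧-∨-lattice lattice

  open Lattice lattice
    using (_≤_; antisym; reflexive; y≤x∨y)
    renaming (trans to ≤-trans)

  ≤0⇒≈0 : ∀ {x} → x ≤ 0# → x ≈ 0#
  ≤0⇒≈0 x≤0 = antisym x≤0 (minimum _)

  ′-antitone : ∀ {x y} → x ≤ y → (y ′) ≤ (x ′)
  ′-antitone {x} {y} x≤y = ≤-trans (y≤x∨y (x ′) (y ′))
    (reflexive (trans (sym (′-deMorgan-∧ x y)) (′-cong (sym x≤y))))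

  -- Negation is an order-reversing involution exchanging 0 and 1, so it carries the
  -- pseudocomplement of `x ′` to the dual pseudocomplement of `x`.
  ′-⁺-smallest : (_* : Op₁ A) →
    (∀ x → IsLargest _≤_ (λ z → (x ∧ z) ≤ 0#) (x *)) →
    ∀ x → IsSmallest _≤_ (λ z → 1# ≤ (x ∨ z)) (((x ′) *) ′)
  ′-⁺-smallest _* *-largest x = 1≤x∨x⁺ , least
    where
    1≤x∨x⁺ : 1# ≤ (x ∨ (((x ′) *) ′))
    1≤x∨x⁺ = ≤-trans (reflexive (sym 0′≈1)) (≤-trans
      (′-antitone (proj₁ (*-largest (x ′))))
      (reflexive (trans (′-deMorgan-∧ (x ′) ((x ′) *))
                        (∨-cong (′-involutive x) refl))))

    least : ∀ z → 1# ≤ (x ∨ z) → (((x ′) *) ′) ≤ z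
    least z 1≤x∨z = ≤-trans
      (′-antitone (proj₂ (*-largest (x ′)) (z ′)
        (≤-trans (reflexive (sym (′-deMorgan-∨ x z)))
          (≤-trans (′-antitone 1≤x∨z) (reflexive 1′≈0)))))
      (reflexive (′-involutive z))

-- The translations between the two varieties.

module RDMP {A : Set c} {_≈_ : Rel A ℓ} {𝐀 : RawDMP A}
  (isRDMP : IsRDMP _≈_ 𝐀) where

  open RawDMP 𝐀
  open DMPTerms 𝐀
  open IsRDMP isRDMP hiding (reflexive)
  open DeMorganAlgebra isDeMorganAlgebra
  open Lattice lattice
    using (_≤_; reflexive; x≤x∨y) renaming (trans to ≤-trans)

  *-largest : ∀ x → IsLargest _≤_ (λ z → x ∧ z ≤ 0#) (x *)
  *-largest x =
    reflexive (proj₁ (*-pseudocomplement x)) ,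
    λ z x∧z≤0 → proj₂ (*-pseudocomplement x) z (≤0⇒≈0 x∧z≤0)

  isRegularDoublePAlgebra :
    IsRegularDoublePAlgebra distributiveLattice _* _⁺ 0# 1#
  isRegularDoublePAlgebra = record
    { minimum    = minimum
    ; maximum    = maximum
    ; *-largest  = *-largest
    ; ⁺-smallest = ′-⁺-smallest _* *-largest
    ; regular    = λ x y → ≤-trans (x≤x∨y _ _) (reflexive (regular x y))
    }

  implication-isResidual : IsResidual lattice implication
  implication-isResidual =
    RegularDoublePAlgebra.⇨-isResidual _ isRegularDoublePAlgebra

  -- In the dual algebra the formula for `⇨` unfolds to `coimplication`.
  coimplication-isResidual : IsResidual dualLattice coimplication
  coimplication-isResidual = RegularDoublePAlgebra.⇨-isResidual _
    (dualIsRegularDoublePAlgebra isRegularDoublePAlgebra)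

  -- Both sides are the largest `z` with `x ∧ z ≤ 0#`; this recovers `*` after the round trip.
  implication-0 : ∀ x → implication x 0# ≈ (x *)
  implication-0 x = largest-unique {_≤_ = _≤_} (Lattice.antisym lattice) id id
    (implication-isResidual x 0#) (*-largest x)

  implication-0-regular : Regular _≈_ _∨_ _∧_ (λ x → implication x 0#) _′
  implication-0-regular x y = trans
    (∨-cong (∧-cong refl (′-cong (implication-0 (x ′))))
            (∨-cong refl (implication-0 y)))
    (trans (regular x y) (∨-cong refl (sym (implication-0 y))))

  isRDMDBLH : IsRDMDBLH _≈_ (𝐀 ^dmdblh)
  isRDMDBLH = record
    { isDeMorganAlgebra = isDeMorganAlgebra
    ; ⇨-cong            = residual-cong lattice implication-isResidual
    ; ⇦-cong            = residual-cong dualLattice coimplication-isResidual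
    ; ⇨-largest         = implication-isResidual
    ; ⇦-smallest        = coimplication-isResidual
    ; regular           = implication-0-regular
    }

  dmdblh-dmp : EqualDMP _≈_ ((𝐀 ^dmdblh) ^dmp) 𝐀
  dmdblh-dmp = record
    { ∨-≈ = λ _ _ → refl
    ; ∧-≈ = λ _ _ → refl
    ; *-≈ = implication-0
    ; ′-≈ = λ _ → refl
    ; 0-≈ = refl
    ; 1-≈ = refl
    }

module RDMDBLH {A : Set c} {_≈_ : Rel A ℓ} {𝐀 : RawDMDBLH A}
  (isRDMDBLH : IsRDMDBLH _≈_ 𝐀) where

  open IsRDMDBLH isRDMDBLH
  open DeMorganAlgebra isDeMorganAlgebra
  open Lattice lattice using () renaming (reflexive to ≤-reflexive)

  isRDMP : IsRDMP _≈_ (𝐀 ^dmp)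
  isRDMP = record
    { isDeMorganAlgebra  = isDeMorganAlgebra
    ; *-cong             = λ x≈y → ⇨-cong x≈y refl
    ; *-pseudocomplement = λ x →
        ≤0⇒≈0 (proj₁ (⇨-largest x _)) ,
        λ z x∧z≈0 → proj₂ (⇨-largest x _) z (≤-reflexive x∧z≈0)
    ; regular            = regular
    }

  dmp-dmdblh : EqualDMDBLH _≈_ ((𝐀 ^dmp) ^dmdblh) 𝐀
  dmp-dmdblh = record
    { ∨-≈ = λ _ _ → refl
    ; ∧-≈ = λ _ _ → refl
    ; ⇨-≈ = residual-unique lattice
              (RDMP.implication-isResidual isRDMP) ⇨-largest
    ; ⇦-≈ = residual-unique dualLattice
              (RDMP.coimplication-isResidual isRDMP) ⇦-smallest
    ; ′-≈ = λ _ → refl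
    ; 0-≈ = refl
    ; 1-≈ = refl
    }

corollary2p9 : ∀ {c ℓ} {A : Set c} (_≈_ : Rel A ℓ) →
    (∀ (𝐀 : RawDMP A) → IsRDMP _≈_ 𝐀 → IsRDMDBLH _≈_ (𝐀 ^dmdblh))
    × (∀ (𝐀 : RawDMDBLH A) → IsRDMDBLH _≈_ 𝐀 → IsRDMP _≈_ (𝐀 ^dmp))
    × (∀ (𝐀 : RawDMP A) → IsRDMP _≈_ 𝐀 → EqualDMP _≈_ ((𝐀 ^dmdblh) ^dmp) 𝐀)
    × (∀ (𝐀 : RawDMDBLH A) → IsRDMDBLH _≈_ 𝐀 → EqualDMDBLH _≈_ ((𝐀 ^dmp) ^dmdblh) 𝐀)
corollary2p9 _ =
    (λ _ → RDMP.isRDMDBLH)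
  , (λ _ → RDMDBLH.isRDMP)
  , (λ _ → RDMP.dmdblh-dmp)
  , (λ _ → RDMDBLH.dmp-dmdblh)
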